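{- Let $X$ be a non-empty complete computable metric space. Then $\mathsf{BCT}_X\equiv_W\mathsf{C_{\mathbb N}}$.
   Context: A represented space is a pair $(X,\delta_X)$ with $\delta_X:\subseteq\mathbb N^{\mathbb N}\to X$ a partial surjection. For a partial multi-valued map $f:\subseteq X\rightrightarrows Y$ between represented spaces, a realizer of $f$ is a partial function $F:\subseteq\mathbb N^{\mathbb N}\to\mathbb N^{\mathbb N}$ with $\delta_Y(F(p))\in f(\delta_X(p))$ for all $p\in\mathrm{dom}(f\circ\delta_X)$. We write $f\le_W g$ (Weihrauch reducibility) if there are computable partial functions $H,K:\subseteq\mathbb N^{\mathbb N}\to\mathbb N^{\mathbb N}$ such that for every realizer $G$ of $g$ the function $p\mapsto H\langle p,G(K(p))\rangle$ is a realizer of $f$, where $\langle\cdot,\cdot\rangle$ is a standard computable pairing on $\mathbb N^{\mathbb N}$. $\equiv_W$ is the induced equivalence. For a computable metric space $X$, $\mathcal A_-(X)$ is the set of closed subsets of $X$, where a name of $A$ is an enumeration of rational open balls (centers from the dense sequence, rational radii) whose union is $X\setminus A$; for $X=\mathbb N$: $p$ names $A$ iff $\mathbb N\setminus A=\{n:n+1\in\mathrm{range}(p)\}$. Sequences in $\mathcal A_-(X)^{\mathbb N}$ are represented by tupling names. $\mathsf{C_{\mathbb N}}:\subseteq\mathcal A_-(\mathbb N)\rightrightarrows\mathbb N$, $A\mapsto A$, on non-empty $A$. $\mathsf{BCT}_X:\subseteq\mathcal A_-(X)^{\mathbb N}\rightrightarrows\mathbb N$, $(A_i)_{i}\mapsto\{n\in\mathbb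 N: A_n\text{ has non-empty interior}\}$, defined on all sequences of closed sets with $\bigcup_i A_i=X$. -}

module Defs where

open import Axiom.ExcludedMiddle using (ExcludedMiddle)
open import Data.Fin.Base using (Fin)
open import Data.Integer.Base as ℤ using (_⊖_; +[1+_]; -[1+_])
open import Data.Nat.Base as ℕ using (ℕ; zero; suc)
import Data.Integer.Properties as ℤ
import Data.Nat.Properties as ℕ
open import Data.Product.Base using (∃; ∃-syntax; _×_; _,_; proj₁; proj₂)
open import Data.Rational.Base as ℚ using (ℚ; mkℚ; 0ℚ; ½; _/_; *≤*; *<*)
import Data.Rational.Properties as ℚ
import Data.Rational.Unnormalised.Base as ℚᵘ
import Data.Rational.Unnormalised.Properties as ℚᵘ
open import Data.Rational.Solver using (module +-*-Solver)
open import Data.Vec.Base using (Vec; []; _∷_; lookup)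
open import Data.Vec.Relation.Binary.Pointwise.Inductive using (Pointwise; []; _∷_)
open import Function.Bundles using (_⇔_; mk⇔; Equivalence)
open import Function.Metric.Structures using (IsGeneralMetric)
open import Level using (Level; 0ℓ; _⊔_) renaming (suc to lsuc)
open import Relation.Binary.Bundles using (Setoid)
open import Relation.Binary.PropositionalEquality.Core
  using (_≡_; _≗_; refl; sym; trans; cong; cong₂; subst; subst₂)
open import Relation.Binary.PropositionalEquality.Properties as ≡ using ()
open import Relation.Binary.Structures using (IsPartialOrder)
open import Relation.Nullary using (¬_; Dec; yes; no; contradiction)
open import Relation.Nullary.Decidable using (decidable-stable)

private
  variable
    a b ℓ ℓ′ : Level
    m n : ℕ

open Equivalence using (to; from)

------------------------------------------------------------------------
-- Pairing

-- The Cantor pairing ⟨ n , k ⟩ = (n + k)(n + k + 1)/2 + k and its inverse.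

triangular : ℕ → ℕ
triangular zero    = 0
triangular (suc n) = suc n ℕ.+ triangular n

pair : ℕ → ℕ → ℕ
pair n k = triangular (n ℕ.+ k) ℕ.+ k

private
  next : ℕ × ℕ → ℕ × ℕ
  next (zero  , k) = suc k , 0
  next (suc n , k) = n , suc k

unpair : ℕ → ℕ × ℕ
unpair zero    = 0 , 0
unpair (suc m) = next (unpair m)

unpair-pair : ∀ n k → unpair (pair n k) ≡ (n , k)
unpair-pair n k = go (n ℕ.+ k) k n refl
  where
  go : ∀ s k n → n ℕ.+ k ≡ s → unpair (triangular s ℕ.+ k) ≡ (n , k)
  go s (suc k) n eq
    rewrite ℕ.+-suc (triangular s) k
          | go s k (suc n) (trans (sym (ℕ.+-suc n k)) eq) = refl
  go zero zero zero refl = refl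
  go (suc s) zero (suc n) eq
    rewrite ℕ.+-identityʳ (s ℕ.+ triangular s)
          | ℕ.+-comm s (triangular s)
          | ℕ.+-identityʳ n
          | go s s 0 refl = cong (λ z → suc z , 0) (sym (ℕ.suc-injective eq))

Baire : Set
Baire = ℕ → ℕ

-- ⟨ p , q ⟩ (2n) = p n  and  ⟨ p , q ⟩ (2n + 1) = q n.

⟨_,_⟩ : Baire → Baire → Baire
⟨ p , q ⟩ zero    = p 0
⟨ p , q ⟩ (suc n) = ⟨ q , (λ i → p (suc i)) ⟩ n

⟨⟩-cong : ∀ {p p′ q q′ : Baire} → p ≗ p′ → q ≗ q′ → ⟨ p , q ⟩ ≗ ⟨ p′ , q′ ⟩
⟨⟩-cong e f zero    = e 0
⟨⟩-cong e f (suc n) = ⟨⟩-cong f (λ i → e (suc i)) n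

------------------------------------------------------------------------
-- Computability on Baire space: μ-recursive functions with an oracle

data Code : ℕ → Set where
  zer    : Code 0
  succ   : Code 1
  oracle : Code 1
  proj   : Fin n → Code n
  comp   : Code m → Vec (Code n) m → Code n
  prec   : Code n → Code (2 ℕ.+ n) → Code (suc n)
  min    : Code (suc n) → Code n

-- p ⊢ e ∙ xs ⇓ y : with oracle p, program e halts on input xs with output y.

data _⊢_∙_⇓_ (p : Baire) : ∀ {n} → Code n → Vec ℕ n → ℕ → Set where
  ⇓zer    : p ⊢ zer ∙ [] ⇓ 0
  ⇓succ   : ∀ {x} → p ⊢ succ ∙ (x ∷ []) ⇓ suc x
  ⇓oracle : ∀ {x} → p ⊢ oracle ∙ (x ∷ []) ⇓ p x
  ⇓proj   : ∀ {i : Fin n} {xs} → p ⊢ proj i ∙ xs ⇓ lookup xs i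
  ⇓comp   : ∀ {f : Code m} {gs : Vec (Code n) m} {xs ys y} →
            Pointwise (λ g z → p ⊢ g ∙ xs ⇓ z) gs ys →
            p ⊢ f ∙ ys ⇓ y → p ⊢ comp f gs ∙ xs ⇓ y
  ⇓prec₀  : ∀ {f : Code n} {g xs y} →
            p ⊢ f ∙ xs ⇓ y → p ⊢ prec f g ∙ (0 ∷ xs) ⇓ y
  ⇓prec₊  : ∀ {f : Code n} {g x xs y z} →
            p ⊢ prec f g ∙ (x ∷ xs) ⇓ y → p ⊢ g ∙ (x ∷ y ∷ xs) ⇓ z →
            p ⊢ prec f g ∙ (suc x ∷ xs) ⇓ z
  ⇓min    : ∀ {f : Code (suc n)} {xs k} →
            (∀ j → j ℕ.< k → ∃[ v ] p ⊢ f ∙ (j ∷ xs) ⇓ suc v) →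
            p ⊢ f ∙ (k ∷ xs) ⇓ 0 → p ⊢ min f ∙ xs ⇓ k

-- A partial function on Baire space, given by its graph; sequences are
-- identified when they agree pointwise.

record PartialFunction : Set₁ where
  field
    graph       : Baire → Baire → Set
    functional  : ∀ {p p′ q q′} → p ≗ p′ → graph p q → graph p′ q′ → q ≗ q′
    extensional : ∀ {p p′ q q′} → p ≗ p′ → q ≗ q′ → graph p q → graph p′ q′

-- One program computes F p from p for all p in the domain of F; its behaviour
-- outside the domain is unconstrained.

Computable : PartialFunction → Set
Computable F =
  ∃[ e ] ∀ {p q} → PartialFunction.graph F p q → ∀ n → p ⊢ e ∙ (n ∷ []) ⇓ q n

-- Ordinary total recursive functions: the oracle plays no role.

Recursive : (Vec ℕ n → ℕ) → Set
Recursive {n} f = ∃[ e ] ∀ p (xs : Vec ℕ n) → p ⊢ e ∙ xs ⇓ f xs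

------------------------------------------------------------------------
-- Real numbers, as Cauchy sequences of rationals

record ℝ : Set where
  field
    seq    : ℕ → ℚ
    cauchy : ∀ ε → 0ℚ ℚ.< ε →
             ∃[ N ] ∀ m n → N ℕ.≤ m → N ℕ.≤ n → seq m ℚ.≤ seq n ℚ.+ ε

open ℝ

infix 4 _≤ℝ_ _<ℝ_ _≃ℝ_
infixl 6 _+ℝ_

_≤ℝ_ _<ℝ_ _≃ℝ_ : ℝ → ℝ → Set
x ≤ℝ y = ∀ ε → 0ℚ ℚ.< ε → ∃[ N ] ∀ n → N ℕ.≤ n → seq x n ℚ.≤ seq y n ℚ.+ ε
x <ℝ y = ∃[ ε ] 0ℚ ℚ.< ε × ∃[ N ] ∀ n → N ℕ.≤ n → seq x n ℚ.+ ε ℚ.≤ seq y n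
x ≃ℝ y = x ≤ℝ y × y ≤ℝ x

private
  half>0 : ∀ {ε} → 0ℚ ℚ.< ε → 0ℚ ℚ.< ½ ℚ.* ε
  half>0 {ε} 0<ε = subst (ℚ._< ½ ℚ.* ε) (ℚ.*-zeroʳ ½) (ℚ.*-monoʳ-<-pos ½ 0<ε)

  halves : ∀ ε → ½ ℚ.* ε ℚ.+ ½ ℚ.* ε ≡ ε
  halves ε = trans (sym (ℚ.*-distribʳ-+ ε ½ ½)) (ℚ.*-identityˡ ε)

  ≤+ : ∀ q {ε} → 0ℚ ℚ.< ε → q ℚ.≤ q ℚ.+ ε
  ≤+ q {ε} 0<ε = subst (ℚ._≤ q ℚ.+ ε) (ℚ.+-identityʳ q) (ℚ.+-monoʳ-≤ q (ℚ.<⇒≤ 0<ε))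

  interchange : ∀ x y u v → (x ℚ.+ u) ℚ.+ (y ℚ.+ v) ≡ (x ℚ.+ y) ℚ.+ (u ℚ.+ v)
  interchange = solve 4 (λ x y u v → (x :+ u) :+ (y :+ v) := (x :+ y) :+ (u :+ v)) refl
    where open +-*-Solver

  swapʳ : ∀ x y z → (x ℚ.+ y) ℚ.+ z ≡ (x ℚ.+ z) ℚ.+ y
  swapʳ = solve 3 (λ x y z → (x :+ y) :+ z := (x :+ z) :+ y) refl
    where open +-*-Solver

fromℚ : ℚ → ℝ
fromℚ q = record { seq = λ _ → q ; cauchy = λ ε 0<ε → 0 , λ _ _ _ _ → ≤+ q 0<ε }

0ℝ : ℝ
0ℝ = fromℚ 0ℚ

_+ℝ_ : ℝ → ℝ → ℝ
(x +ℝ y) .seq n = seq x n ℚ.+ seq y n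
(x +ℝ y) .cauchy ε 0<ε
  with M , f ← cauchy x (½ ℚ.* ε) (half>0 0<ε)
  with N , g ← cauchy y (½ ℚ.* ε) (half>0 0<ε)
  = M ℕ.⊔ N , λ m n p q →
      subst (_ ℚ.≤_)
        (trans (interchange (seq x n) (seq y n) (½ ℚ.* ε) (½ ℚ.* ε))
               (cong (seq x n ℚ.+ seq y n ℚ.+_) (halves ε)))
        (ℚ.+-mono-≤
          (f m n (ℕ.m⊔n≤o⇒m≤o M N p) (ℕ.m⊔n≤o⇒m≤o M N q))
          (g m n (ℕ.m⊔n≤o⇒n≤o M N p) (ℕ.m⊔n≤o⇒n≤o M N q)))

≤ℝ-refl : ∀ {x} → x ≤ℝ x
≤ℝ-refl ε 0<ε = 0 , λ n _ → ≤+ _ 0<ε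

≤ℝ-trans : ∀ {x y z} → x ≤ℝ y → y ≤ℝ z → x ≤ℝ z
≤ℝ-trans {x} {y} {z} x≤y y≤z ε 0<ε
  with M , f ← x≤y (½ ℚ.* ε) (half>0 0<ε)
  with N , g ← y≤z (½ ℚ.* ε) (half>0 0<ε)
  = M ℕ.⊔ N , λ n p →
      subst (_ ℚ.≤_)
        (trans (ℚ.+-assoc (seq z n) _ _) (cong (seq z n ℚ.+_) (halves ε)))
        (ℚ.≤-trans (f n (ℕ.m⊔n≤o⇒m≤o M N p))
          (ℚ.+-monoˡ-≤ (½ ℚ.* ε) (g n (ℕ.m⊔n≤o⇒n≤o M N p))))

≤ℝ-isPartialOrder : IsPartialOrder _≃ℝ_ _≤ℝ_
≤ℝ-isPartialOrder = record
  { isPreorder = record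
    { isEquivalence = record
      { refl  = λ {x} → ≤ℝ-refl {x} , ≤ℝ-refl {x}
      ; sym   = λ (p , q) → q , p
      ; trans = λ {x} {y} {z} (p , q) (p′ , q′) →
                  ≤ℝ-trans {x} {y} {z} p p′ , ≤ℝ-trans {z} {y} {x} q′ q
      }
    ; reflexive = proj₁
    ; trans     = λ {x} {y} {z} → ≤ℝ-trans {x} {y} {z}
    }
  ; antisym = _,_
  }

-- Within x q ε : ∣ x − q ∣ ≤ ε.

Within : ℝ → ℚ → ℚ → Set
Within x q ε = fromℚ (q ℚ.- ε) ≤ℝ x × x ≤ℝ fromℚ (q ℚ.+ ε)

2^-_ : ℕ → ℚ
2^- k = (ℤ.+ 1 / (2 ℕ.^ k)) {{ℕ.m^n≢0 2 k}}

-- Rationals are given to programs as (u − v)/(w + 1) with u, v, w natural.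

ComputableDoubleSequence : (ℕ → ℕ → ℝ) → Set
ComputableDoubleSequence x =
  ∃[ u ] ∃[ v ] ∃[ w ] Recursive {3} u × Recursive {3} v × Recursive {3} w ×
  ∀ i j k → let ijk = i ∷ j ∷ k ∷ [] in
  Within (x i j) ((u ijk ⊖ v ijk) / suc (w ijk)) (2^- k)

------------------------------------------------------------------------
-- Metric spaces

record MetricSpace : Set₁ where
  field
    Carrier  : Set
    _≈_      : Carrier → Carrier → Set
    d        : Carrier → Carrier → ℝ
    isMetric : IsGeneralMetric _≈_ _≃ℝ_ _≤ℝ_ 0ℝ _+ℝ_ d

  open IsGeneralMetric isMetric public
    using (triangle; nonNegative) renaming (sym to d-sym)

  Interior : (Carrier → Set) → Carrier → Set
  Interior A x = ∃[ ε ] 0ℚ ℚ.< ε × (∀ y → d x y <ℝ fromℚ ε → A y)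

  IsOpen : (Carrier → Set) → Set
  IsOpen U = ∀ x → U x → Interior U x

  IsClosed : (Carrier → Set) → Set
  IsClosed A = IsOpen (λ x → ¬ A x)

  ClosedSet : Set₁
  ClosedSet = ∃[ A ] IsClosed A

  IsCauchy : (ℕ → Carrier) → Set
  IsCauchy x = ∀ ε → 0ℚ ℚ.< ε →
    ∃[ N ] ∀ m n → N ℕ.≤ m → N ℕ.≤ n → d (x m) (x n) <ℝ fromℚ ε

  _ConvergesTo_ : (ℕ → Carrier) → Carrier → Set
  x ConvergesTo l = ∀ ε → 0ℚ ℚ.< ε →
    ∃[ N ] ∀ n → N ℕ.≤ n → d (x n) l <ℝ fromℚ ε

  Complete : Set
  Complete = ∀ x → IsCauchy x → ∃[ l ] x ConvergesTo l

record ComputableMetricSpace : Set₁ where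
  field
    metricSpace : MetricSpace

  open MetricSpace metricSpace public

  field
    α            : ℕ → Carrier
    dense        : ∀ x ε → 0ℚ ℚ.< ε → ∃[ n ] d x (α n) <ℝ fromℚ ε
    d-computable : ComputableDoubleSequence (λ i j → d (α i) (α j))

  -- The rational open ball with code ⟨ n , ⟨ i , k ⟩ ⟩ is B(α n, i/(k+1));
  -- i = 0 gives the empty ball.

  Ball : ℕ → Carrier → Set
  Ball c x =
    let n , c′ = unpair c
        i , k  = unpair c′
    in d (α n) x <ℝ fromℚ (ℤ.+ i / suc k)

------------------------------------------------------------------------
-- Represented spaces and Weihrauch reducibility

-- p ⊩ x : p is a name of x, that is, p lies in the domain of the
-- representation δ and δ p = x.

record RepresentedSpace c ℓ : Set (lsuc (c ⊔ ℓ)) where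
  field
    setoid : Setoid c ℓ

  open Setoid setoid public using (Carrier; _≈_)

  field
    _⊩_        : Baire → Carrier → Set
    respects   : ∀ {p q x y} → p ≗ q → x ≈ y → p ⊩ x → q ⊩ y
    unique     : ∀ {p x y} → p ⊩ x → p ⊩ y → x ≈ y
    surjective : ∀ x → ∃[ p ] p ⊩ x

-- A partial multi-valued map.  The domain is given explicitly; values at
-- points outside it are irrelevant.

record MultiMap (X : RepresentedSpace a ℓ) (Y : RepresentedSpace b ℓ′) :
                Set (lsuc 0ℓ ⊔ a ⊔ ℓ ⊔ b ⊔ ℓ′) where
  private
    module X = RepresentedSpace X
    module Y = RepresentedSpace Y
  field
    dom       : X.Carrier → Set
    val       : X.Carrier → Y.Carrier → Set
    dom-resp  : ∀ {x x′} → x X.≈ x′ → dom x → dom x′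
    val-resp  : ∀ {x x′ y y′} → x X.≈ x′ → y Y.≈ y′ → val x y → val x′ y′

module _ {X : RepresentedSpace a ℓ} {Y : RepresentedSpace b ℓ′} where
  private
    module X = RepresentedSpace X
    module Y = RepresentedSpace Y

  _Realizes_ : PartialFunction → MultiMap X Y → Set (a ⊔ b)
  F Realizes f = ∀ p x → p X.⊩ x → MultiMap.dom f x →
    ∃[ q ] PartialFunction.graph F p q × ∃[ y ] q Y.⊩ y × MultiMap.val f x y

-- The partial function p ↦ H ⟨ p , G (K p) ⟩.

compose : (H G K : PartialFunction) → PartialFunction
compose H G K = record
  { graph       = λ p r → ∃[ q ] ∃[ s ] K.graph p q × G.graph q s × H.graph ⟨ p , s ⟩ r
  ; functional  = λ e (_ , _ , k , g , h) (_ , _ , k′ , g′ , h′) →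
      H.functional (⟨⟩-cong e (G.functional (K.functional e k k′) g g′)) h h′
  ; extensional = λ e e′ (q , s , k , g , h) →
      q , s , K.extensional e (λ _ → refl) k , g ,
      H.extensional (⟨⟩-cong e (λ _ → refl)) e′ h
  }
  where
  module H = PartialFunction H
  module G = PartialFunction G
  module K = PartialFunction K

private
  variable
    c₁ c₂ c₃ c₄ ℓ₁ ℓ₂ ℓ₃ ℓ₄ : Level
    X : RepresentedSpace c₁ ℓ₁
    Y : RepresentedSpace c₂ ℓ₂
    Z : RepresentedSpace c₃ ℓ₃
    W : RepresentedSpace c₄ ℓ₄

infix 4 _≤W_ _≡W_

_≤W_ : MultiMap X Y → MultiMap Z W → Set _
f ≤W g = ∃[ H ] ∃[ K ] Computable H × Computable K ×
  (∀ G → G Realizes g → compose H G K Realizes f)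

_≡W_ : MultiMap X Y → MultiMap Z W → Set _
f ≡W g = f ≤W g × g ≤W f

------------------------------------------------------------------------
-- The represented spaces and problems

ℕ-space : RepresentedSpace 0ℓ 0ℓ
ℕ-space = record
  { setoid     = ≡.setoid ℕ
  ; _⊩_        = λ p n → p 0 ≡ n
  ; respects   = λ e e′ e″ → trans (sym (e 0)) (trans e″ e′)
  ; unique     = λ e e′ → trans (sym e) e′
  ; surjective = λ n → (λ _ → n) , refl
  }

-- Sequences in X: p names (xᵢ)ᵢ when, for every i, k ↦ p ⟨ i , k ⟩ names xᵢ.

Sequences : RepresentedSpace a ℓ → RepresentedSpace a ℓ
Sequences X = record
  { setoid = record
    { Carrier       = ℕ → Carrier
    ; _≈_           = λ x y → ∀ i → x i ≈ y i
    ; isEquivalence = record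
      { refl  = λ _ → S.refl
      ; sym   = λ e i → S.sym (e i)
      ; trans = λ e e′ i → S.trans (e i) (e′ i)
      }
    }
  ; _⊩_        = λ p x → ∀ i → (λ k → p (pair i k)) ⊩ x i
  ; respects   = λ e e′ r i → respects (λ k → e (pair i k)) (e′ i) (r i)
  ; unique     = λ r r′ i → unique (r i) (r′ i)
  ; surjective = λ x →
      (λ m → let i , k = unpair m in proj₁ (surjective (x i)) k) ,
      (λ i → respects
        (λ k → sym (cong (λ (i , k) → proj₁ (surjective (x i)) k) (unpair-pair i k)))
        S.refl (proj₂ (surjective (x i))))
  }
  where
  open RepresentedSpace X
  module S = Setoid setoid

private
  subsetSetoid : ∀ {c} {S : Set c} {A : Set} → (S → A → Set) → Setoid c 0ℓ
  subsetSetoid {S = S} mem = record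
    { Carrier       = S
    ; _≈_           = λ A B → ∀ x → mem A x ⇔ mem B x
    ; isEquivalence = record
      { refl  = λ _ → mk⇔ (λ z → z) (λ z → z)
      ; sym   = λ e x → mk⇔ (from (e x)) (to (e x))
      ; trans = λ e e′ x →
          mk⇔ (λ z → to (e′ x) (to (e x) z)) (λ z → from (e x) (from (e′ x) z))
      }
    }

  contra : {P Q : Set} → P ⇔ Q → (¬ P) ⇔ (¬ Q)
  contra e = mk⇔ (λ np q → np (from e q)) (λ nq p → nq (to e p))

  ⇔-trans : {P Q R : Set} → P ⇔ Q → Q ⇔ R → P ⇔ R
  ⇔-trans e f = mk⇔ (λ z → to f (to e z)) (λ z → from e (from f z))

  ⇔-sym : {P Q : Set} → P ⇔ Q → Q ⇔ P
  ⇔-sym e = mk⇔ (from e) (to e)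

-- Excluded middle is what makes these representations single-valued and
-- surjective: a closed set is not constructively determined by the points
-- outside it, nor need it have a name.

private
  determined : ExcludedMiddle 0ℓ → {P Q R : Set} → (¬ P) ⇔ R → (¬ Q) ⇔ R → P ⇔ Q
  determined em e f = mk⇔
    (λ p → decidable-stable em (λ nq → from e (to f nq) p))
    (λ q → decidable-stable em (λ np → from f (to e np) q))

-- 𝒜₋(ℕ): p names A when ℕ ∖ A = { n : n + 1 ∈ range p }.

𝒜₋ℕ : ExcludedMiddle 0ℓ → RepresentedSpace (lsuc 0ℓ) 0ℓ
𝒜₋ℕ em = record
  { setoid     = subsetSetoid {S = ℕ → Set} (λ A n → A n)
  ; _⊩_        = λ p A → ∀ n → (¬ A n) ⇔ (∃[ k ] p k ≡ suc n)
  ; respects   = λ e e′ r n → ⇔-trans (⇔-sym (contra (e′ n))) (⇔-trans (r n)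
      (mk⇔ (λ (k , h) → k , trans (sym (e k)) h) (λ (k , h) → k , trans (e k) h)))
  ; unique     = λ r r′ n → determined em (r n) (r′ n)
  ; surjective = λ A → name A , λ n → mk⇔ (complete A n) (λ (k , h) → sound A n k em h)
  }
  where
  choose : {P : Set} → Dec P → ℕ → ℕ
  choose (yes _) k = 0
  choose (no _)  k = suc k

  name : (ℕ → Set) → Baire
  name A k = choose (em {A k}) k

  complete : ∀ A n → ¬ A n → ∃[ k ] name A k ≡ suc n
  complete A n ¬An with em {A n} in eq
  ... | yes An = contradiction An ¬An
  ... | no _   = n , cong (λ z → choose z n) eq

  sound : ∀ A n k (z : Dec (A k)) → choose z k ≡ suc n → ¬ A n
  sound A n .n (no ¬An) refl = ¬An

-- 𝒜₋(X): p names A when X ∖ A is the union of the balls enumerated by p.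

module _ (X : ComputableMetricSpace) where
  open ComputableMetricSpace X

  private
    archimedean : ∀ ε → 0ℚ ℚ.< ε → ∃[ k ] ℤ.+ 1 / suc k ℚ.≤ ε
    archimedean (mkℚ (ℤ.+ 0)  k c) (*<* (ℤ.+<+ ()))
    archimedean (mkℚ +[1+ n ] k c) _ = k , ℚ.toℚᵘ-cancel-≤
      (ℚᵘ.≤-respˡ-≃ (ℚᵘ.≃-sym (ℚ.toℚᵘ-fromℚᵘ (ℚᵘ.mkℚᵘ (ℤ.+ 1) k)))
        (ℚᵘ.*≤* (ℤ.*-monoʳ-≤-nonNeg (ℤ.+ suc k) (ℤ.+≤+ (ℕ.s≤s (ℕ.z≤n {n}))))))
    archimedean (mkℚ -[1+ n ] k c) (*<* ())

    1/suc>0 : ∀ k → 0ℚ ℚ.< ℤ.+ 1 / suc k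
    1/suc>0 k = ℚ.positive⁻¹ _ {{ℚ.normalize-pos 1 (suc k)}}

    ≤-<-trans : ∀ {x y q} → x ≤ℝ y → y <ℝ fromℚ q → x <ℝ fromℚ q
    ≤-<-trans {x} {y} x≤y (ε , 0<ε , M , f)
      with N , g ← x≤y (½ ℚ.* ε) (half>0 0<ε)
      = ½ ℚ.* ε , half>0 0<ε , M ℕ.⊔ N , λ n p →
          ℚ.≤-trans (ℚ.+-monoˡ-≤ (½ ℚ.* ε) (g n (ℕ.m⊔n≤o⇒n≤o M N p)))
            (subst (ℚ._≤ _)
              (sym (trans (ℚ.+-assoc (seq y n) _ _) (cong (seq y n ℚ.+_) (halves ε))))
              (f n (ℕ.m⊔n≤o⇒m≤o M N p)))

    +-<-half : ∀ {x y q ε} → q ℚ.≤ ½ ℚ.* ε →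
               x <ℝ fromℚ q → y <ℝ fromℚ q → (x +ℝ y) <ℝ fromℚ ε
    +-<-half {x} {y} {q} {ε} q≤ (δ , 0<δ , M , f) (δ′ , 0<δ′ , N , g) =
      δ , 0<δ , M ℕ.⊔ N , λ n p →
        subst₂ ℚ._≤_ (swapʳ (seq x n) δ (seq y n)) (halves ε)
          (ℚ.+-mono-≤
            (ℚ.≤-trans (f n (ℕ.m⊔n≤o⇒m≤o M N p)) q≤)
            (ℚ.≤-trans (≤+ (seq y n) 0<δ′)
              (ℚ.≤-trans (g n (ℕ.m⊔n≤o⇒n≤o M N p)) q≤)))

    Ball-0-empty : ∀ {x} → ¬ Ball 0 x
    Ball-0-empty {x} (ε , 0<ε , M , f)
      with N , g ← nonNegative {α 0} {x} (½ ℚ.* ε) (half>0 0<ε)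
      = ℚ.<-irrefl refl (ℚ.<-≤-trans
          (ℚ.≤-<-trans (g k (ℕ.m≤n⊔m M N)) (ℚ.+-monoʳ-< s half<))
          (f k (ℕ.m≤m⊔n M N)))
      where
      k     = M ℕ.⊔ N
      s     = seq (d (α 0) x) k
      half< : ½ ℚ.* ε ℚ.< ε
      half< = subst₂ ℚ._<_ (ℚ.+-identityˡ _) (halves ε)
                (ℚ.+-monoˡ-< (½ ℚ.* ε) (half>0 0<ε))

    Ball-pair : ∀ n i k y →
                Ball (pair n (pair i k)) y ≡ (d (α n) y <ℝ fromℚ (ℤ.+ i / suc k))
    Ball-pair n i k y rewrite unpair-pair n (pair i k) | unpair-pair i k = refl

    Avoids : (Carrier → Set) → ℕ → Set
    Avoids A c = ∀ y → Ball c y → ¬ A y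

    avoiding-ball : ∀ ((A , _) : ClosedSet) x → ¬ A x → ∃[ c ] Ball c x × Avoids A c
    avoiding-ball (A , closed) x x∉A
      with ε , 0<ε , h ← closed x x∉A
      with k , q≤ ← archimedean (½ ℚ.* ε) (half>0 0<ε)
      with n , lt ← dense x (ℤ.+ 1 / suc k) (1/suc>0 k)
      = pair n (pair 1 k)
      , subst (λ S → S) (sym (Ball-pair n 1 k x))
          (≤-<-trans {d (α n) x} {d x (α n)} (proj₁ (d-sym (α n) x)) lt)
      , λ y y∈B → h y
          (≤-<-trans {d x y} {d x (α n) +ℝ d (α n) y} (triangle x (α n) y)
            (+-<-half {d x (α n)} {d (α n) y} q≤ lt
              (subst (λ S → S) (Ball-pair n 1 k y) y∈B)))

    choose : {P : Set} → Dec P → ℕ → ℕ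
    choose (yes _) c = c
    choose (no _)  c = 0

  𝒜₋ : ExcludedMiddle 0ℓ → RepresentedSpace (lsuc 0ℓ) 0ℓ
  𝒜₋ em = record
    { setoid     = subsetSetoid {S = ClosedSet} (λ (A , _) x → A x)
    ; _⊩_        = λ p (A , _) → ∀ x → (¬ A x) ⇔ (∃[ j ] Ball (p j) x)
    ; respects   = λ e e′ r x → ⇔-trans (⇔-sym (contra (e′ x))) (⇔-trans (r x) (mk⇔
        (λ (j , h) → j , subst (λ c → Ball c x) (e j) h)
        (λ (j , h) → j , subst (λ c → Ball c x) (sym (e j)) h)))
    ; unique     = λ r r′ x → determined em (r x) (r′ x)
    ; surjective = λ A → name A , λ x → mk⇔
        (λ x∉A → let c , x∈B , av = avoiding-ball A x x∉A in
           c , covers em av x∈B)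
        (λ (j , h) → sound em h)
    }
    where
    name : ClosedSet → Baire
    name (A , _) c = choose (em {Avoids A c}) c

    covers : ∀ {A : Carrier → Set} {c x} (z : Dec (Avoids A c)) →
             Avoids A c → Ball c x → Ball (choose z c) x
    covers (yes _) _  h = h
    covers (no ¬a) av _ = contradiction av ¬a

    sound : ∀ {A : Carrier → Set} {c x} (z : Dec (Avoids A c)) →
            Ball (choose z c) x → ¬ A x
    sound {x = x} (yes av) h = av x h
    sound         (no _)   h = contradiction h Ball-0-empty

-- Closed choice on ℕ.

Cℕ : (em : ExcludedMiddle 0ℓ) → MultiMap (𝒜₋ℕ em) ℕ-space
Cℕ em = record
  { dom      = λ A → ∃[ n ] A n
  ; val      = λ A n → A n
  ; dom-resp = λ e (n , h) → n , to (e n) h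
  ; val-resp = λ { {y = n} e refl h → to (e n) h }
  }

-- The Baire category theorem as a problem: from closed sets covering X, find
-- the index of one with non-empty interior.

BCT : (em : ExcludedMiddle 0ℓ) (X : ComputableMetricSpace) →
      MultiMap (Sequences (𝒜₋ X em)) ℕ-space
BCT em X = record
  { dom      = λ A → ∀ x → ∃[ i ] proj₁ (A i) x
  ; val      = λ A n → ∃[ x ] Interior (proj₁ (A n)) x
  ; dom-resp = λ e h x → let i , m = h x in i , to (e i x) m
  ; val-resp = λ { {y = n} e refl (x , ε , 0<ε , h) →
                   x , ε , 0<ε , λ y lt → to (e n y) (h y lt) }
  }
  where open ComputableMetricSpace X

{-# OPTIONS --safe #-}
-- BCT ≤ C_ℕ: a ball B(α a, 1/(r+1)) fails to lie inside A n exactly when some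
-- dense point belongs both to it and to a ball enumerated into the complement
-- of A n, which is semi-decidable.  So the codes of the pairs (n, ball) with the
-- ball inside A n form a set with a computable negative name, non-empty by the
-- Baire category theorem; C_ℕ picks such a pair, and its first component solves
-- the problem.
--
-- C_ℕ ≤ BCT: with A n = X for n in A and A n = ∅ otherwise, the sets A n
-- cover X, and A n has non-empty interior only for n in A.

module Submission where

open import Defs
open import Axiom.ExcludedMiddle using (ExcludedMiddle)
open import Data.Fin.Base using (Fin)
open import Data.Fin.Patterns using (0F; 1F; 2F; 3F)
open import Data.Integer.Base as ℤ using (_⊖_; +[1+_]; -[1+_])
import Data.Integer.Properties as ℤ
import Data.Integer.Solver as ℤ
open import Data.Nat.Base as ℕ using (ℕ; zero; suc; _+_; _∸_; _*_; _^_; pred)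
import Data.Nat.Properties as ℕ
open import Data.Product.Base using (∃-syntax; _×_; _,_; proj₁; proj₂)
open import Data.Rational.Base as ℚ using (ℚ; mkℚ; 0ℚ; 1ℚ; ½; _/_; *<*)
import Data.Rational.Properties as ℚ
open import Data.Rational.Solver using (module +-*-Solver)
import Data.Rational.Unnormalised.Base as ℚᵘ
import Data.Rational.Unnormalised.Properties as ℚᵘ
open import Data.Sum.Base using (inj₁; inj₂)
open import Data.Vec.Base using (Vec; []; _∷_; lookup; map)
open import Data.Vec.Relation.Binary.Pointwise.Inductive using (Pointwise; []; _∷_)
open import Data.Vec.Relation.Unary.All using (All; []; _∷_)
open import Function.Bundles using (_⇔_; mk⇔; Equivalence)
open import Function.Metric.Structures using (IsGeneralMetric)
open import Level using (0ℓ)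
open import Relation.Binary.PropositionalEquality.Core
  using (_≡_; _≗_; refl; sym; trans; cong; cong₂; subst; subst₂)
open import Relation.Nullary using (¬_; yes; no; contradiction)
open import Relation.Nullary.Decidable using (decidable-stable)

open Equivalence using (to; from)
open ℝ using (seq)

-- Recursive functions

recursive-resp : ∀ {n} {f g : Vec ℕ n → ℕ} → f ≗ g → Recursive f → Recursive g
recursive-resp f≗g (e , c) = e , λ p xs → subst (p ⊢ e ∙ xs ⇓_) (f≗g xs) (c p xs)

var : ∀ {n} (i : Fin n) → Recursive (λ xs → lookup xs i)
var i = proj i , λ p xs → ⇓proj

substitute : ∀ {m n} {f : Vec ℕ m → ℕ} {gs : Vec (Vec ℕ n → ℕ) m} →
             Recursive f → All Recursive gs → Recursive (λ xs → f (map (λ g → g xs) gs))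
substitute {gs = gs} (e , c) rs =
  comp e (codes rs) , λ p xs → ⇓comp (runs rs p xs) (c p (map (λ g → g xs) gs))
  where
  codes : ∀ {m n} {gs : Vec (Vec ℕ n → ℕ) m} → All Recursive gs → Vec (Code n) m
  codes []             = []
  codes ((e , _) ∷ rs) = e ∷ codes rs

  runs : ∀ {m n} {gs : Vec (Vec ℕ n → ℕ) m} (rs : All Recursive gs) p xs →
         Pointwise (λ e y → p ⊢ e ∙ xs ⇓ y) (codes rs) (map (λ g → g xs) gs)
  runs []             p xs = []
  runs ((_ , c) ∷ rs) p xs = c p xs ∷ runs rs p xs

-- With `h` given and the recursion equations as hypotheses, arithmetic functions keep their usual
-- definitions and most equations hold by `refl`.
primitive-recursion :
  ∀ {n} {f : Vec ℕ n → ℕ} {g : Vec ℕ (2 + n) → ℕ} (h : Vec ℕ (suc n) → ℕ) →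
  Recursive f → Recursive g →
  (∀ xs → h (0 ∷ xs) ≡ f xs) → (∀ x xs → h (suc x ∷ xs) ≡ g (x ∷ h (x ∷ xs) ∷ xs)) →
  Recursive h
primitive-recursion h (e , c) (e′ , c′) base step = prec e e′ , run
  where
  run : ∀ p xs → p ⊢ prec e e′ ∙ xs ⇓ h xs
  run p (zero  ∷ xs) = subst (p ⊢ _ ∙ _ ⇓_) (sym (base xs)) (⇓prec₀ (c p xs))
  run p (suc x ∷ xs) = subst (p ⊢ _ ∙ _ ⇓_) (sym (step x xs))
    (⇓prec₊ (run p (x ∷ xs)) (c′ p _))

suc-recursive : Recursive {1} (λ xs → suc (lookup xs 0F))
suc-recursive = succ , λ { p (x ∷ []) → ⇓succ {x = x} }

zero-recursive : ∀ {n} → Recursive {n} (λ _ → 0)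
zero-recursive = comp zer [] , λ p xs → ⇓comp [] ⇓zer

sucᴿ : ∀ {n} {f : Vec ℕ n → ℕ} → Recursive f → Recursive (λ xs → suc (f xs))
sucᴿ r = substitute suc-recursive (r ∷ [])

constᴿ : ∀ {n} k → Recursive {n} (λ _ → k)
constᴿ zero    = zero-recursive
constᴿ (suc k) = sucᴿ (constᴿ k)

+-recursive : Recursive {2} (λ xs → lookup xs 0F + lookup xs 1F)
+-recursive = primitive-recursion _ (var 0F) (sucᴿ (var 1F)) (λ _ → refl) (λ _ _ → refl)

module _ {n : ℕ} {f g : Vec ℕ n → ℕ} where

  infixl 6 _+ᴿ_ _∸ᴿ_
  infixl 7 _*ᴿ_

  _+ᴿ_ : Recursive f → Recursive g → Recursive (λ xs → f xs + g xs)
  r +ᴿ s = substitute +-recursive (r ∷ s ∷ [])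

  _*ᴿ_ : Recursive f → Recursive g → Recursive (λ xs → f xs * g xs)
  r *ᴿ s = substitute *-recursive (r ∷ s ∷ [])
    where
    *-recursive : Recursive {2} (λ xs → lookup xs 0F * lookup xs 1F)
    *-recursive = primitive-recursion _ zero-recursive
      (substitute +-recursive (var 2F ∷ var 1F ∷ [])) (λ _ → refl) (λ _ _ → refl)

  _∸ᴿ_ : Recursive f → Recursive g → Recursive (λ xs → f xs ∸ g xs)
  -- The arguments are swapped: `prec` recurses on the first input, which must be the subtracted
  -- number.
  r ∸ᴿ s = substitute ∸-recursive (s ∷ r ∷ [])
    where
    pred-recursive : Recursive {1} (λ xs → pred (lookup xs 0F))
    pred-recursive =
      primitive-recursion _ zero-recursive (var 0F) (λ _ → refl) (λ _ _ → refl)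

    ∸-recursive : Recursive {2} (λ xs → lookup xs 1F ∸ lookup xs 0F)
    ∸-recursive = primitive-recursion _ (var 0F)
      (substitute pred-recursive (var 1F ∷ [])) (λ _ → refl)
      (λ x xs → sym (ℕ.pred[m∸n]≡m∸[1+n] (lookup xs 0F) x))

2^ᴿ_ : ∀ {n} {f : Vec ℕ n → ℕ} → Recursive f → Recursive (λ xs → 2 ^ f xs)
2^ᴿ r = substitute 2^-recursive (r ∷ [])
  where
  2^-recursive : Recursive {1} (λ xs → 2 ^ lookup xs 0F)
  2^-recursive = primitive-recursion _ (constᴿ 1) (constᴿ 2 *ᴿ var 1F)
    (λ _ → refl) (λ _ _ → refl)

ifZero : ℕ → ℕ → ℕ → ℕ
ifZero zero    a b = a
ifZero (suc _) a b = b

-- The default 0 is never a successor, so the value must come from the zero branch.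
ifZero-suc : ∀ {n c c′} → ifZero n (suc c) 0 ≡ suc c′ → n ≡ 0 × c ≡ c′
ifZero-suc {zero} refl = refl , refl

ifZeroᴿ : ∀ {n} {f g h : Vec ℕ n → ℕ} → Recursive f → Recursive g → Recursive h →
          Recursive (λ xs → ifZero (f xs) (g xs) (h xs))
ifZeroᴿ r s t = substitute ifZero-recursive (r ∷ s ∷ t ∷ [])
  where
  ifZero-recursive :
    Recursive {3} (λ xs → ifZero (lookup xs 0F) (lookup xs 1F) (lookup xs 2F))
  ifZero-recursive =
    primitive-recursion _ (var 0F) (var 3F) (λ _ → refl) (λ _ _ → refl)

triangularᴿ : ∀ {n} {f : Vec ℕ n → ℕ} → Recursive f → Recursive (λ xs → triangular (f xs))
triangularᴿ r = substitute triangular-recursive (r ∷ [])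
  where
  triangular-recursive : Recursive {1} (λ xs → triangular (lookup xs 0F))
  triangular-recursive = primitive-recursion _ zero-recursive (sucᴿ (var 0F) +ᴿ var 1F)
    (λ _ → refl) (λ _ _ → refl)

pairᴿ : ∀ {n} {f g : Vec ℕ n → ℕ} → Recursive f → Recursive g →
        Recursive (λ xs → pair (f xs) (g xs))
pairᴿ r s = triangularᴿ (r +ᴿ s) +ᴿ s

-- Inverting the pairing

left right : ℕ → ℕ
left  s = proj₁ (unpair s)
right s = proj₂ (unpair s)

-- The index n + k of the diagonal on which s = ⟨ n , k ⟩ lies satisfies a
-- recursion of its own, from which n and k are then read off.

diagonal : ℕ → ℕ
diagonal zero    = 0
diagonal (suc s) = let t = diagonal s in t + (1 ∸ (t ∸ (s ∸ triangular t)))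

private
  right′ left′ : ℕ → ℕ
  right′ s = s ∸ triangular (diagonal s)
  left′  s = diagonal s ∸ right′ s

  read-off : ∀ s n k → diagonal s ≡ n + k → triangular (n + k) + k ≡ s →
             left′ s ≡ n × right′ s ≡ k
  read-off s n k e e′ = trans (cong₂ _∸_ e r) (ℕ.m+n∸n≡m n k) , r
    where
    r : right′ s ≡ k
    r = trans (cong₂ _∸_ (sym e′) (cong triangular e)) (ℕ.m+n∸m≡n (triangular (n + k)) k)

  -- The term subtracted from 1 in `diagonal` is the left component of `s`. It is zero exactly at
  -- the end of a diagonal, and only there does the index increase.
  diagonal-spec : ∀ s → let n , k = unpair s in
                  diagonal s ≡ n + k × triangular (n + k) + k ≡ s
  diagonal-spec zero = refl , refl
  diagonal-spec (suc s)
    with unpair s | diagonal-spec s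
  ... | zero , k | e , e′ =
    trans (cong (λ z → diagonal s + (1 ∸ z)) (proj₁ (read-off s 0 k e e′)))
      (trans (cong (_+ 1) e) (trans (ℕ.+-comm k 1) (sym (ℕ.+-identityʳ (suc k))))) ,
    trans (ℕ.+-identityʳ _) (trans (cong triangular (ℕ.+-identityʳ (suc k)))
      (cong suc (trans (ℕ.+-comm k (triangular k)) e′)))
  ... | suc n , k | e , e′ =
    trans (cong (λ z → diagonal s + (1 ∸ z)) (proj₁ (read-off s (suc n) k e e′)))
      (trans (cong (diagonal s +_) (ℕ.0∸n≡0 n))
        (trans (ℕ.+-identityʳ _) (trans e (sym (ℕ.+-suc n k))))) ,
    trans (cong (λ z → triangular z + suc k) (ℕ.+-suc n k))
      (trans (ℕ.+-suc _ k) (cong suc e′))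

  read-off-unpair : ∀ s → left′ s ≡ left s × right′ s ≡ right s
  read-off-unpair s = read-off s (left s) (right s)
    (proj₁ (diagonal-spec s)) (proj₂ (diagonal-spec s))

  diagonalᴿ : ∀ {n} {f : Vec ℕ n → ℕ} → Recursive f → Recursive (λ xs → diagonal (f xs))
  diagonalᴿ r = substitute diagonal-recursive (r ∷ [])
    where
    diagonal-recursive : Recursive {1} (λ xs → diagonal (lookup xs 0F))
    diagonal-recursive = primitive-recursion _ zero-recursive
      (var 1F +ᴿ (constᴿ 1 ∸ᴿ (var 1F ∸ᴿ (var 0F ∸ᴿ triangularᴿ (var 1F)))))
      (λ _ → refl) (λ _ _ → refl)

module _ {n : ℕ} {f : Vec ℕ n → ℕ} where

  private
    right′ᴿ : Recursive f → Recursive (λ xs → right′ (f xs))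
    right′ᴿ r = r ∸ᴿ triangularᴿ (diagonalᴿ r)

  leftᴿ : Recursive f → Recursive (λ xs → left (f xs))
  leftᴿ r = recursive-resp (λ xs → proj₁ (read-off-unpair (f xs))) (diagonalᴿ r ∸ᴿ right′ᴿ r)

  rightᴿ : Recursive f → Recursive (λ xs → right (f xs))
  rightᴿ r = recursive-resp (λ xs → proj₂ (read-off-unpair (f xs))) (right′ᴿ r)

left-pair : ∀ n k → left (pair n k) ≡ n
left-pair n k = cong proj₁ (unpair-pair n k)

right-pair : ∀ n k → right (pair n k) ≡ k
right-pair n k = cong proj₂ (unpair-pair n k)

-- Functionals that put a single question to the oracle

query : (ℕ → ℕ) → (ℕ → ℕ → ℕ) → Baire → Baire
query i g p x = g x (p (i x))

queryFunction : (ℕ → ℕ) → (ℕ → ℕ → ℕ) → PartialFunction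
queryFunction i g = record
  { graph       = λ p q → q ≗ query i g p
  ; functional  = λ e h h′ x → trans (h x) (trans (cong (g x) (e (i x))) (sym (h′ x)))
  ; extensional = λ e e′ h x → trans (sym (e′ x)) (trans (h x) (cong (g x) (e (i x))))
  }

query-computable : ∀ i g → Recursive {1} (λ xs → i (lookup xs 0F)) →
                   Recursive {2} (λ xs → g (lookup xs 0F) (lookup xs 1F)) →
                   Computable (queryFunction i g)
query-computable i g (e , c) (e′ , c′) =
  comp e′ (proj 0F ∷ comp oracle (e ∷ []) ∷ []) , λ {p} h n →
    subst (p ⊢ _ ∙ _ ⇓_) (sym (h n))
      (⇓comp (⇓proj ∷ ⇓comp (c p (n ∷ []) ∷ []) ⇓oracle ∷ []) (c′ p (n ∷ p (i n) ∷ [])))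

-- Rational numbers

p-q+q≡p : ∀ p q → (p ℚ.- q) ℚ.+ q ≡ p
p-q+q≡p = solve 2 (λ p q → (p :- q) :+ q := p) refl
  where open +-*-Solver

p+q-q≡p : ∀ p q → (p ℚ.+ q) ℚ.- q ≡ p
p+q-q≡p = solve 2 (λ p q → (p :+ q) :- q := p) refl
  where open +-*-Solver

p+[q-p]≡q : ∀ p q → p ℚ.+ (q ℚ.- p) ≡ q
p+[q-p]≡q p q = trans (ℚ.+-comm p _) (p-q+q≡p q p)

p<q⇒0<q-p : ∀ {p q} → p ℚ.< q → 0ℚ ℚ.< q ℚ.- p
p<q⇒0<q-p {p} {q} p<q = subst (ℚ._< q ℚ.- p) (ℚ.+-inverseʳ p) (ℚ.+-monoˡ-< (ℚ.- p) p<q)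

p≤q+[s-r]⇒q≤r⇒p≤s : ∀ {p q r s} → p ℚ.≤ q ℚ.+ (s ℚ.- r) → q ℚ.≤ r → p ℚ.≤ s
p≤q+[s-r]⇒q≤r⇒p≤s {p} {q} {r} {s} le q≤r = ℚ.≤-trans le
  (subst (q ℚ.+ (s ℚ.- r) ℚ.≤_) (p+[q-p]≡q r s) (ℚ.+-monoˡ-≤ (s ℚ.- r) {q} {r} q≤r))

½+½ : ∀ p → ½ ℚ.* p ℚ.+ ½ ℚ.* p ≡ p
½+½ p = trans (sym (ℚ.*-distribʳ-+ p ½ ½)) (ℚ.*-identityˡ p)

0<½ : ∀ {p} → 0ℚ ℚ.< p → 0ℚ ℚ.< ½ ℚ.* p
0<½ {p} 0<p = subst (ℚ._< ½ ℚ.* p) (ℚ.*-zeroʳ ½) (ℚ.*-monoʳ-<-pos ½ 0<p)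

p≤p+p : ∀ p → 0ℚ ℚ.< p → p ℚ.≤ p ℚ.+ p
p≤p+p p 0<p = subst (ℚ._≤ p ℚ.+ p) (ℚ.+-identityʳ p) (ℚ.+-monoʳ-≤ p (ℚ.<⇒≤ 0<p))

/-mono-≤ : ∀ i m j n → i ℤ.* ℤ.+ suc n ℤ.≤ j ℤ.* ℤ.+ suc m → i / suc m ℚ.≤ j / suc n
/-mono-≤ i m j n le = ℚ.toℚᵘ-cancel-≤
  (ℚᵘ.≤-respˡ-≃ (ℚᵘ.≃-sym (ℚ.toℚᵘ-fromℚᵘ (ℚᵘ.mkℚᵘ i m)))
    (ℚᵘ.≤-respʳ-≃ (ℚᵘ.≃-sym (ℚ.toℚᵘ-fromℚᵘ (ℚᵘ.mkℚᵘ j n))) (ℚᵘ.*≤* le)))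

rad : ℕ → ℚ
rad k = ℤ.+ 1 / suc k

rad-positive : ∀ k → 0ℚ ℚ.< rad k
rad-positive k = ℚ.positive⁻¹ _ {{ℚ.normalize-pos 1 (suc k)}}

1/-antitone : ∀ {k} n .{{_ : ℕ.NonZero n}} → suc k ℕ.≤ n → ℤ.+ 1 / n ℚ.≤ rad k
1/-antitone {k} (suc n) le = /-mono-≤ (ℤ.+ 1) n (ℤ.+ 1) k
  (ℤ.*-monoˡ-≤-nonNeg (ℤ.+ 1) (ℤ.+≤+ le))

-- A positive fraction has numerator at least 1, so its own denominator serves.
rad-archimedean : ∀ {ε} → 0ℚ ℚ.< ε → ∃[ k ] rad k ℚ.≤ ε
rad-archimedean {mkℚ (ℤ.+ 0)  k c} (*<* (ℤ.+<+ ()))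
rad-archimedean {mkℚ +[1+ n ] k c} _ = k , ℚ.toℚᵘ-cancel-≤
  (ℚᵘ.≤-respˡ-≃ (ℚᵘ.≃-sym (ℚ.toℚᵘ-fromℚᵘ (ℚᵘ.mkℚᵘ (ℤ.+ 1) k)))
    (ℚᵘ.*≤* (ℤ.*-monoʳ-≤-nonNeg (ℤ.+ suc k) (ℤ.+≤+ (ℕ.s≤s (ℕ.z≤n {n}))))))
rad-archimedean {mkℚ -[1+ n ] k c} (*<* ())

n<2^n : ∀ n → n ℕ.< 2 ^ n
n<2^n zero    = ℕ.s≤s ℕ.z≤n
n<2^n (suc n) = ℕ.≤-trans (ℕ.+-mono-≤ (ℕ.m^n>0 2 n) (n<2^n n))
  (ℕ.≤-reflexive (cong (2 ^ n ℕ.+_) (sym (ℕ.+-identityʳ (2 ^ n)))))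

2^-≤rad : ∀ k → 2^- k ℚ.≤ rad k
2^-≤rad k = 1/-antitone (2 ^ k) {{ℕ.m^n≢0 2 k}} (n<2^n k)

-- Rational inequalities as inequalities of natural numbers

private
  pos-[uv+w]x : ∀ u v w x → ℤ.+ ((u ℕ.* v ℕ.+ w) ℕ.* x) ≡
                            (ℤ.+ u ℤ.* ℤ.+ v ℤ.+ ℤ.+ w) ℤ.* ℤ.+ x
  pos-[uv+w]x u v w x = trans (ℤ.pos-* (u ℕ.* v ℕ.+ w) x) (cong (ℤ._* ℤ.+ x)
    (trans (ℤ.pos-+ (u ℕ.* v) w) (cong (ℤ._+ ℤ.+ w) (ℤ.pos-* u v))))

  -- Adding `v * r * t` cancels the negative part of `u ⊖ v`; `rhs` adds the same term to the other
  -- side.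
  lhs : ∀ u v t w r →
    ((u ⊖ v) ℤ.* ℤ.+ t ℤ.+ ℤ.+ 1 ℤ.* ℤ.+ w) ℤ.* ℤ.+ r ℤ.+ ℤ.+ v ℤ.* ℤ.+ r ℤ.* ℤ.+ t ≡
    ℤ.+ ((u ℕ.* t ℕ.+ w) ℕ.* r)
  lhs u v t w r = trans
    (cong (λ i → (i ℤ.* ℤ.+ t ℤ.+ ℤ.+ 1 ℤ.* ℤ.+ w) ℤ.* ℤ.+ r ℤ.+ ℤ.+ v ℤ.* ℤ.+ r ℤ.* ℤ.+ t)
      (sym (ℤ.m-n≡m⊖n u v)))
    (trans
      (solve 5 (λ u v t w r →
        ((u :- v) :* t :+ con (ℤ.+ 1) :* w) :* r :+ v :* r :* t := (u :* t :+ w) :* r)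
        refl (ℤ.+ u) (ℤ.+ v) (ℤ.+ t) (ℤ.+ w) (ℤ.+ r))
      (sym (pos-[uv+w]x u t w r)))
    where open ℤ.+-*-Solver

  rhs : ∀ i v t w r →
    ℤ.+ i ℤ.* ℤ.+ (w ℕ.* t) ℤ.+ ℤ.+ v ℤ.* ℤ.+ r ℤ.* ℤ.+ t ≡
    ℤ.+ ((i ℕ.* w ℕ.+ v ℕ.* r) ℕ.* t)
  rhs i v t w r = trans
    (cong (λ j → ℤ.+ i ℤ.* j ℤ.+ ℤ.+ v ℤ.* ℤ.+ r ℤ.* ℤ.+ t) (ℤ.pos-* w t))
    (trans
      (solve 5 (λ i v t w r → i :* (w :* t) :+ v :* r :* t := (i :* w :+ v :* r) :* t)
        refl (ℤ.+ i) (ℤ.+ v) (ℤ.+ t) (ℤ.+ w) (ℤ.+ r))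
      (sym (trans (pos-[uv+w]x i w (v ℕ.* r) t)
        (cong (λ j → (ℤ.+ i ℤ.* ℤ.+ w ℤ.+ j) ℤ.* ℤ.+ t) (ℤ.pos-* v r)))))
    where open ℤ.+-*-Solver

-- Both sides are moved so that no subtraction occurs on the right.

clear-denominators : ∀ u v w t .{{_ : ℕ.NonZero t}} i r →
  ((u ⊖ v) / suc w ℚ.+ ℤ.+ 1 / t ℚ.< ℤ.+ i / suc r) ⇔
  ((u ℕ.* t ℕ.+ suc w) ℕ.* suc r ℕ.< (i ℕ.* suc w ℕ.+ v ℕ.* suc r) ℕ.* t)
clear-denominators u v w t@(suc t′) i r = mk⇔
  (λ lt → ℤ.drop‿+<+ (subst₂ ℤ._<_ x+z≡ y+z≡ (ℤ.+-monoˡ-< z (ℚᵘ.drop-*<*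
    (ℚᵘ.<-respˡ-≃ a+b≃ (ℚᵘ.<-respʳ-≃ c≃ (ℚ.toℚᵘ-mono-< lt)))))))
  (λ lt → ℚ.toℚᵘ-cancel-< (ℚᵘ.<-respˡ-≃ (ℚᵘ.≃-sym a+b≃) (ℚᵘ.<-respʳ-≃ (ℚᵘ.≃-sym c≃)
    (ℚᵘ.*<* (subst₂ ℤ._<_ (cancel x z) (cancel y z)
      (ℤ.+-monoˡ-< (ℤ.- z) (subst₂ ℤ._<_ (sym x+z≡) (sym y+z≡) (ℤ.+<+ lt))))))))
  where
  open ℤ.+-*-Solver
  a = ℚᵘ.mkℚᵘ (u ⊖ v) w
  b = ℚᵘ.mkℚᵘ (ℤ.+ 1) t′
  c = ℚᵘ.mkℚᵘ (ℤ.+ i) r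

  a+b≃ : ℚ.toℚᵘ ((u ⊖ v) / suc w ℚ.+ ℤ.+ 1 / t) ℚᵘ.≃ a ℚᵘ.+ b
  a+b≃ = ℚᵘ.≃-trans (ℚ.toℚᵘ-homo-+ ((u ⊖ v) / suc w) (ℤ.+ 1 / t))
    (ℚᵘ.+-cong (ℚ.toℚᵘ-fromℚᵘ a) (ℚ.toℚᵘ-fromℚᵘ b))

  c≃ : ℚ.toℚᵘ (ℤ.+ i / suc r) ℚᵘ.≃ c
  c≃ = ℚ.toℚᵘ-fromℚᵘ c

  x = ((u ⊖ v) ℤ.* ℤ.+ t ℤ.+ ℤ.+ 1 ℤ.* ℤ.+ suc w) ℤ.* ℤ.+ suc r
  y = ℤ.+ i ℤ.* ℤ.+ (suc w ℕ.* t)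
  z = ℤ.+ v ℤ.* ℤ.+ suc r ℤ.* ℤ.+ t

  cancel : ∀ x z → (x ℤ.+ z) ℤ.- z ≡ x
  cancel = solve 2 (λ x z → (x :+ z) :- z := x) refl

  x+z≡ = lhs u v t (suc w) (suc r)
  y+z≡ = rhs i v t (suc w) (suc r)

-- Strict rational upper bounds of real numbers

-- The gap in the strict inequality is absorbed into the bound, so real inequalities become eventual
-- bounds on the rational sequence.
<ℝ⇒bounded : ∀ x {q} → x <ℝ fromℚ q →
             ∃[ q′ ] q′ ℚ.< q × ∃[ N ] ∀ n → N ℕ.≤ n → seq x n ℚ.≤ q′
<ℝ⇒bounded x {q} (ε , 0<ε , N , h) =
  q ℚ.- ε ,
  subst₂ ℚ._<_ (ℚ.+-identityʳ (q ℚ.- ε)) (p-q+q≡p q ε) (ℚ.+-monoʳ-< (q ℚ.- ε) 0<ε) ,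
  N , λ n N≤n → subst (ℚ._≤ q ℚ.- ε) (p+q-q≡p (seq x n) ε) (ℚ.+-monoˡ-≤ (ℚ.- ε) (h n N≤n))

bounded⇒<ℝ : ∀ x {q q′} → q′ ℚ.< q → ∃[ N ] (∀ n → N ℕ.≤ n → seq x n ℚ.≤ q′) →
             x <ℝ fromℚ q
bounded⇒<ℝ x {q} {q′} q′<q (N , h) =
  q ℚ.- q′ , p<q⇒0<q-p q′<q , N , λ n N≤n →
    subst (seq x n ℚ.+ (q ℚ.- q′) ℚ.≤_) (p+[q-p]≡q q′ q) (ℚ.+-monoˡ-≤ (q ℚ.- q′) (h n N≤n))

≤-<ℝ-trans : ∀ x y {q} → x ≤ℝ y → y <ℝ fromℚ q → x <ℝ fromℚ q
≤-<ℝ-trans x y {q} x≤y y<q =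
  let q′ , q′<q , M , f = <ℝ⇒bounded y {q} y<q
      -- `x ≤ℝ y` holds only up to a positive slack. The slack `m - q′` moves the bound from `q′` to
      -- `m`, still strictly below `q`.
      m , q′<m , m<q    = ℚ.<-dense q′<q
      N , g             = x≤y (m ℚ.- q′) (p<q⇒0<q-p q′<m)
  in bounded⇒<ℝ x {q} {m} m<q (M ℕ.⊔ N , λ n le →
       p≤q+[s-r]⇒q≤r⇒p≤s {q = seq y n} {r = q′} {s = m}
         (g n (ℕ.m⊔n≤o⇒n≤o M N le)) (f n (ℕ.m⊔n≤o⇒m≤o M N le)))

<-≤ℝ-trans : ∀ x {p q} → x <ℝ fromℚ p → p ℚ.≤ q → x <ℝ fromℚ q
<-≤ℝ-trans x (ε , 0<ε , N , h) p≤q = ε , 0<ε , N , λ n le → ℚ.≤-trans (h n le) p≤q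

+-mono-<ℝ : ∀ x y {p q} → x <ℝ fromℚ p → y <ℝ fromℚ q → (x +ℝ y) <ℝ fromℚ (p ℚ.+ q)
+-mono-<ℝ x y {p} {q} x<p y<q =
  let p′ , p′<p , M , f = <ℝ⇒bounded x {p} x<p
      q′ , q′<q , N , g = <ℝ⇒bounded y {q} y<q
  in bounded⇒<ℝ (x +ℝ y) {p ℚ.+ q} {p′ ℚ.+ q′} (ℚ.+-mono-< {p′} {p} {q′} {q} p′<p q′<q)
       (M ℕ.⊔ N , λ n le →
         ℚ.+-mono-≤ {seq x n} {p′} {seq y n} {q′}
           (f n (ℕ.m⊔n≤o⇒m≤o M N le)) (g n (ℕ.m⊔n≤o⇒n≤o M N le)))

<ℝ-dense : ∀ x {q} → x <ℝ fromℚ q → ∃[ m ] m ℚ.< q × x <ℝ fromℚ m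
<ℝ-dense x {q} x<q =
  let q′ , q′<q , h = <ℝ⇒bounded x {q} x<q
      m , q′<m , m<q = ℚ.<-dense q′<q
  in m , m<q , bounded⇒<ℝ x {m} {q′} q′<m h

fromℚ-mono-< : ∀ {p q} → p ℚ.< q → fromℚ p <ℝ fromℚ q
fromℚ-mono-< {p} {q} p<q = bounded⇒<ℝ (fromℚ p) {q} {p} p<q (0 , λ _ _ → ℚ.≤-refl)

fromℚ-cancel-< : ∀ {p q} → fromℚ p <ℝ fromℚ q → p ℚ.< q
fromℚ-cancel-< {p} {q} p<q =
  let q′ , q′<q , N , h = <ℝ⇒bounded (fromℚ p) {q} p<q
  in ℚ.≤-<-trans (h N ℕ.≤-refl) q′<q

within⇒<ℝ : ∀ x {q r ε} → Within x r ε → r ℚ.+ ε ℚ.< q → x <ℝ fromℚ q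
within⇒<ℝ x {q} {r} {ε} (_ , x≤) lt =
  ≤-<ℝ-trans x (fromℚ (r ℚ.+ ε)) {q} x≤ (fromℚ-mono-< {r ℚ.+ ε} {q} lt)

-- Choose `m` with `x < m < q` and precision `δ` at most half of `q - m`. Then `r - δ < m` gives
-- `r + δ < m + 2δ ≤ q`.
<ℝ⇒within : ∀ x {q} → x <ℝ fromℚ q →
            ∃[ k ] ∀ r → Within x r (2^- k) → r ℚ.+ 2^- k ℚ.< q
<ℝ⇒within x {q} x<q =
  let m , m<q , x<m = <ℝ-dense x {q} x<q
      k , rad≤      = rad-archimedean (0<½ (p<q⇒0<q-p m<q))
      δ≤            = ℚ.≤-trans (2^-≤rad k) rad≤
  in k , λ r (≤x , _) →
       fine (2^- k) r m δ≤ (fromℚ-cancel-< {r ℚ.- 2^- k} {m}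
         (≤-<ℝ-trans (fromℚ (r ℚ.- 2^- k)) x {m} ≤x x<m))
  where
  fine : ∀ δ r m → δ ℚ.≤ ½ ℚ.* (q ℚ.- m) → r ℚ.- δ ℚ.< m → r ℚ.+ δ ℚ.< q
  fine δ r m δ≤ lt = subst₂ ℚ._<_
    (solve 2 (λ r δ → (r :- δ) :+ (δ :+ δ) := r :+ δ) refl r δ)
    (trans (cong (m ℚ.+_) (½+½ (q ℚ.- m))) (p+[q-p]≡q m q))
    (ℚ.+-mono-<-≤ lt (ℚ.+-mono-≤ δ≤ δ≤))
    where open +-*-Solver

-- Open balls and the Baire category theorem

module _ (X : ComputableMetricSpace) where
  open ComputableMetricSpace X
  open IsGeneralMetric isMetric using (≈⇒0; module EqC)

  Near : Carrier → ℚ → Carrier → Set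
  Near x q y = d x y <ℝ fromℚ q

  near-sym : ∀ x y {q} → Near x q y → Near y q x
  near-sym x y {q} = ≤-<ℝ-trans (d y x) (d x y) {q} (proj₁ (d-sym y x))

  near-trans : ∀ x y z {p q} → Near x p y → Near y q z → Near x (p ℚ.+ q) z
  near-trans x y z {p} {q} xy yz =
    ≤-<ℝ-trans (d x z) (d x y +ℝ d y z) {p ℚ.+ q} (triangle x y z)
      (+-mono-<ℝ (d x y) (d y z) {p} {q} xy yz)

  near-refl : ∀ x {q} → 0ℚ ℚ.< q → Near x q x
  near-refl x {q} 0<q =
    ≤-<ℝ-trans (d x x) 0ℝ {q} (proj₁ (≈⇒0 EqC.refl)) (fromℚ-mono-< {0ℚ} {q} 0<q)

  near-mono : ∀ x y {p q} → p ℚ.≤ q → Near x p y → Near x q y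
  near-mono x y {p} {q} p≤q xy = <-≤ℝ-trans (d x y) {p} {q} xy p≤q

  near-open : ∀ x {q} → IsOpen (Near x q)
  near-open x {q} y xy =
    let m , m<q , xy′ = <ℝ-dense (d x y) {q} xy
    in q ℚ.- m , p<q⇒0<q-p m<q , λ z yz →
         subst (λ r → Near x r z) (p+[q-p]≡q m q) (near-trans x y z {m} {q ℚ.- m} xy′ yz)

  interior-∩ : ∀ {U V : Carrier → Set} {x} → Interior U x → Interior V x →
               Interior (λ y → U y × V y) x
  interior-∩ {x = x} (ε , 0<ε , u) (δ , 0<δ , v) with ℚ.≤-total ε δ
  ... | inj₁ ε≤δ = ε , 0<ε , λ y xy → u y xy , v y (near-mono x y {ε} {δ} ε≤δ xy)
  ... | inj₂ δ≤ε = δ , 0<δ , λ y xy → u y (near-mono x y {δ} {ε} δ≤ε xy) , v y xy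

  dense-point : ∀ {U : Carrier → Set} {x} → Interior U x → ∃[ n ] U (α n)
  dense-point {x = x} (ε , 0<ε , u) = let n , xn = dense x ε 0<ε in n , u (α n) xn

  basic-ball : ∀ {U : Carrier → Set} {x} → Interior U x → ∀ N →
               ∃[ a ] ∃[ k ] N ℕ.≤ k × (∀ y → Near (α a) (rad k ℚ.+ rad k) y → U y)
  basic-ball {x = x} (ε , 0<ε , u) N =
    -- With `ρ` at most a quarter of `ε`, the distance from `x` to `α a` and the doubled radius add
    -- up to `3ρ`, below `ε`.
    let k₀ , k₀≤ = rad-archimedean (0<½ (0<½ 0<ε))
        k        = k₀ ℕ.⊔ N
        ρ        = rad k
        ρ≤       = ℚ.≤-trans (1/-antitone (suc k) (ℕ.s≤s (ℕ.m≤m⊔n k₀ N))) k₀≤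
        2ρ≤      = subst (ρ ℚ.+ ρ ℚ.≤_) (½+½ (½ ℚ.* ε)) (ℚ.+-mono-≤ ρ≤ ρ≤)
        ρ+2ρ≤    = subst (ρ ℚ.+ (ρ ℚ.+ ρ) ℚ.≤_) (½+½ ε)
                     (ℚ.+-mono-≤ (ℚ.≤-trans (p≤p+p ρ (rad-positive k)) 2ρ≤) 2ρ≤)
        a , xa   = dense x ρ (rad-positive k)
    in a , k , ℕ.m≤n⊔m k₀ N , λ y ay →
         u y (near-mono x y {ρ ℚ.+ (ρ ℚ.+ ρ)} {ε} ρ+2ρ≤
               (near-trans x (α a) y {ρ} {ρ ℚ.+ ρ} xa ay))

  InsideBall : (Carrier → Set) → ℕ → ℕ → Set
  InsideBall A a k = ∀ y → Near (α a) (rad k) y → A y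

  -- Inside A ⟨ n , ⟨ a , k ⟩ ⟩ : the ball B(α a, 1/(k+1)) is contained in A n.

  Inside : (ℕ → ClosedSet) → ℕ → Set
  Inside A s = InsideBall (proj₁ (A (left s))) (left (right s)) (right (right s))

  inside-pair : ∀ A n a k →
                Inside A (pair n (pair a k)) ≡ InsideBall (proj₁ (A n)) a k
  inside-pair A n a k rewrite unpair-pair n (pair a k) | unpair-pair a k = refl

  outside-point : ExcludedMiddle 0ℓ → ∀ {A : Carrier → Set} {a k} →
                  ¬ InsideBall A a k → ∃[ y ] Near (α a) (rad k) y × ¬ A y
  outside-point em {A} {a} {k} ¬inside with em {∃[ y ] Near (α a) (rad k) y × ¬ A y}
  ... | yes y = y
  ... | no ¬y = contradiction
    (λ y ay → decidable-stable em (λ y∉A → ¬y (y , ay , y∉A))) ¬inside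

  module _ (complete : Complete) (A : ℕ → ClosedSet) where

    -- The bound `n ≤ l` drives the radii to zero. The doubled radius leaves room for the limit of
    -- the centers, which need not lie in the open balls themselves.
    Shrinking : Set
    Shrinking = ∀ n a k → ∃[ b ] ∃[ l ] n ℕ.≤ l ×
      (∀ z → Near (α b) (rad l ℚ.+ rad l) z → Near (α a) (rad k) z × ¬ proj₁ (A n) z)

    -- If no ball lies inside any A n, shrinking balls avoiding A 0, A 1, …
    -- in turn converge to a point outside all of them.

    module Avoid (shrink : Shrinking) where

      center index : ℕ → ℕ
      center zero    = 0
      center (suc n) = proj₁ (shrink n (center n) (index n))
      index zero     = 0
      index (suc n)  = proj₁ (proj₂ (shrink n (center n) (index n)))

      c : ℕ → Carrier
      c n = α (center n)

      ρ : ℕ → ℚ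
      ρ n = rad (index n)

      0<ρ : ∀ n → 0ℚ ℚ.< ρ n
      0<ρ n = rad-positive (index n)

      n≤index : ∀ n → n ℕ.≤ index (suc n)
      n≤index n = proj₁ (proj₂ (proj₂ (shrink n (center n) (index n))))

      shrunk : ∀ n z → Near (c (suc n)) (ρ (suc n) ℚ.+ ρ (suc n)) z →
               Near (c n) (ρ n) z × ¬ proj₁ (A n) z
      shrunk n = proj₂ (proj₂ (proj₂ (shrink n (center n) (index n))))

      -- Induction on `≤′` peels off the last ball, which lies in its double and hence, by `shrunk`,
      -- in the ball before it.
      nested : ∀ {n m} → n ℕ.≤′ m → ∀ z → Near (c m) (ρ m) z → Near (c n) (ρ n) z
      nested (ℕ.≤′-reflexive refl)    z mz = mz
      nested {m = suc m} (ℕ.≤′-step n≤m) z mz = nested n≤m z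
        (proj₁ (shrunk m z (near-mono (c (suc m)) z {ρ (suc m)} {ρ (suc m) ℚ.+ ρ (suc m)}
          (p≤p+p (ρ (suc m)) (0<ρ (suc m))) mz)))

      tail : ∀ {n m} → n ℕ.≤ m → Near (c n) (ρ n) (c m)
      tail {n} {m} n≤m = nested (ℕ.≤⇒≤′ n≤m) (c m) (near-refl (c m) {ρ m} (0<ρ m))

      c-cauchy : IsCauchy c
      c-cauchy ε 0<ε =
        let N , rad≤ = rad-archimedean (0<½ 0<ε)
            c′       = c (suc N)
            r        = ρ (suc N)
            -- Stage `suc N` has index at least `N`, so its radius is at most half of `ε`; all later
            -- centers lie in that ball.
            r≤       = ℚ.≤-trans (1/-antitone (suc (index (suc N))) (ℕ.s≤s (n≤index N))) rad≤
            2r≤      = subst (r ℚ.+ r ℚ.≤_) (½+½ ε) (ℚ.+-mono-≤ r≤ r≤)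
        in suc N , λ m n N<m N<n →
             near-mono (c m) (c n) {r ℚ.+ r} {ε} 2r≤
               (near-trans (c m) c′ (c n) {r} {r} (near-sym c′ (c m) {r} (tail N<m)) (tail N<n))

      limit : Carrier
      limit = proj₁ (complete c c-cauchy)

      -- A late center lies in the `n`-th ball, and the limit is within `ρ n` of that center.
      limit-near : ∀ n → Near (c n) (ρ n ℚ.+ ρ n) limit
      limit-near n =
        let N , close = proj₂ (complete c c-cauchy) (ρ n) (0<ρ n)
            m         = n ℕ.⊔ N
        in near-trans (c n) (c m) limit {ρ n} {ρ n}
             (tail (ℕ.m≤m⊔n n N)) (close m (ℕ.m≤n⊔m n N))

      limit∉ : ∀ n → ¬ proj₁ (A n) limit
      limit∉ n = proj₂ (shrunk n limit (limit-near (suc n)))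

    -- Otherwise every ball meets the complement of every `A n` in a non-empty open set, which has
    -- room for the next ball, and the limit escapes the cover.
    baire : ExcludedMiddle 0ℓ → (∀ x → ∃[ i ] proj₁ (A i) x) → ∃[ s ] Inside A s
    baire em cover with em {∃[ s ] Inside A s}
    ... | yes s = s
    ... | no ¬s = let n , l∈A = cover limit in contradiction l∈A (limit∉ n)
      where
      outside : ∀ n a k → ∃[ y ] Near (α a) (rad k) y × ¬ proj₁ (A n) y
      outside n a k = outside-point em {proj₁ (A n)} {a} {k} λ inside →
        ¬s (pair n (pair a k) , subst (λ S → S) (sym (inside-pair A n a k)) inside)

      shrink : Shrinking
      shrink n a k =
        let y , ay , y∉A = outside n a k
        in basic-ball {λ z → Near (α a) (rad k) z × ¬ proj₁ (A n) z} {y}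
             (interior-∩ {Near (α a) (rad k)} {λ z → ¬ proj₁ (A n) z} {y}
               (near-open (α a) {rad k} y ay) (proj₂ (A n) y y∉A)) n

      open Avoid shrink

-- Semi-deciding membership of dense points in rational balls

module _ (X : ComputableMetricSpace) where
  open ComputableMetricSpace X

  u v w : Vec ℕ 3 → ℕ
  u = proj₁ d-computable
  v = proj₁ (proj₂ d-computable)
  w = proj₁ (proj₂ (proj₂ d-computable))

  -- test a m i r k ≡ 0 when the k-th approximation shows d(α a , α m) < i/(r+1).

  test : ℕ → ℕ → ℕ → ℕ → ℕ → ℕ
  test a m i r k =
    suc ((u (a ∷ m ∷ k ∷ []) * 2 ^ k + suc (w (a ∷ m ∷ k ∷ []))) * suc r) ∸
    (i * suc (w (a ∷ m ∷ k ∷ [])) + v (a ∷ m ∷ k ∷ []) * suc r) * 2 ^ k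

  testᴿ : ∀ {n} {a m i r k : Vec ℕ n → ℕ} →
          Recursive a → Recursive m → Recursive i → Recursive r → Recursive k →
          Recursive (λ xs → test (a xs) (m xs) (i xs) (r xs) (k xs))
  testᴿ ra rm ri rr rk =
    sucᴿ ((at u-recursive *ᴿ 2^ᴿ rk +ᴿ sucᴿ (at w-recursive)) *ᴿ sucᴿ rr) ∸ᴿ
    (ri *ᴿ sucᴿ (at w-recursive) +ᴿ at v-recursive *ᴿ sucᴿ rr) *ᴿ 2^ᴿ rk
    where
    u-recursive : Recursive u
    u-recursive = proj₁ (proj₂ (proj₂ (proj₂ d-computable)))
    v-recursive : Recursive v
    v-recursive = proj₁ (proj₂ (proj₂ (proj₂ (proj₂ d-computable))))
    w-recursive : Recursive w
    w-recursive = proj₁ (proj₂ (proj₂ (proj₂ (proj₂ (proj₂ d-computable)))))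

    at : {f : Vec ℕ 3 → ℕ} → Recursive f → Recursive (λ xs → f (_ ∷ _ ∷ _ ∷ []))
    at r = substitute r (ra ∷ rm ∷ rk ∷ [])

  private
    approximation : ℕ → ℕ → ℕ → ℚ
    approximation a m k =
      (u (a ∷ m ∷ k ∷ []) ⊖ v (a ∷ m ∷ k ∷ [])) / suc (w (a ∷ m ∷ k ∷ []))

    approximates : ∀ a m k → Within (d (α a) (α m)) (approximation a m k) (2^- k)
    approximates = proj₂ (proj₂ (proj₂ (proj₂ (proj₂ (proj₂ d-computable)))))

    -- The omitted side is the inequality from `clear-denominators` with `t = 2 ^ k`. The leading
    -- `suc` in `test` makes the truncated difference vanish exactly when this strict inequality
    -- holds.
    test⇔ : ∀ a m i r k → (approximation a m k ℚ.+ 2^- k ℚ.< ℤ.+ i / suc r) ⇔ _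
    test⇔ a m i r k = clear-denominators (u amk) (v amk) (w amk) (2 ^ k) {{ℕ.m^n≢0 2 k}} i r
      where amk = a ∷ m ∷ k ∷ []

  test-sound : ∀ a m i r k → test a m i r k ≡ 0 → Near X (α a) (ℤ.+ i / suc r) (α m)
  test-sound a m i r k e =
    within⇒<ℝ (d (α a) (α m)) {ℤ.+ i / suc r} {approximation a m k} {2^- k}
      (approximates a m k) (from (test⇔ a m i r k) (ℕ.m∸n≡0⇒m≤n e))

  test-complete : ∀ a m i r → Near X (α a) (ℤ.+ i / suc r) (α m) → ∃[ k ] test a m i r k ≡ 0
  test-complete a m i r am =
    let k , lt = <ℝ⇒within (d (α a) (α m)) {ℤ.+ i / suc r} am
    in k , ℕ.m≤n⇒m∸n≡0 (to (test⇔ a m i r k) (lt (approximation a m k) (approximates a m k)))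

  -- The intersection of the balls is open, so the search for a common point can be restricted to
  -- dense points, whose distances are computable.
  common-point : ∀ a r b y → Near X (α a) (rad r) y → Ball b y →
                 ∃[ m ] Near X (α a) (rad r) (α m) × Ball b (α m)
  common-point a r b y ay by =
    dense-point X {λ z → Near X (α a) (rad r) z × Ball b z} {y}
      (interior-∩ X {Near X (α a) (rad r)} {Ball b} {y}
        (near-open X (α a) {rad r} y ay)
        (near-open X (α (left b)) {ℤ.+ left (right b) / suc (right (right b))} y by))

-- The two reductions

-- A stage s = (c , j , m , k , l) excludes the ball c = ⟨ n , ⟨ a , r ⟩ ⟩ as
-- soon as the approximations of precision k and l put α m into both this ball
-- and the j-th ball enumerated into the complement of A n.

module BCT≤Cℕ (em : ExcludedMiddle 0ℓ) (X : ComputableMetricSpace) where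
  open ComputableMetricSpace X

  Stage : Set
  Stage = ℕ × ℕ × ℕ × ℕ × ℕ

  encode : Stage → ℕ
  encode (c , j , m , k , l) = pair c (pair j (pair m (pair k l)))

  decode : ℕ → Stage
  decode s =
    left s , left (right s) , left (right (right s)) ,
    left (right (right (right s))) , right (right (right (right s)))

  decode-encode : ∀ s → decode (encode s) ≡ s
  decode-encode (c , j , m , k , l)
    rewrite unpair-pair c (pair j (pair m (pair k l)))
          | unpair-pair j (pair m (pair k l))
          | unpair-pair m (pair k l)
          | unpair-pair k l = refl

  -- The sum is a conjunction: it is zero exactly when both tests succeed.
  meets : Stage → ℕ → ℕ
  meets (c , j , m , k , l) b =
    test X (left (right c)) m 1 (right (right c)) k +
    test X (left b) m (left (right b)) (right (right b)) l

  question : Stage → ℕ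
  question (c , j , m , k , l) = pair (left c) j

  -- In a negative name the entry `suc c` excludes `c`, and the default 0 excludes nothing.
  answer : Stage → ℕ → ℕ
  answer s b = ifZero (meets s b) (suc (proj₁ s)) 0

  K : PartialFunction
  K = queryFunction (λ s → question (decode s)) (λ s → answer (decode s))

  K-computable : Computable K
  K-computable = query-computable (λ s → question (decode s)) (λ s → answer (decode s))
    (pairᴿ (leftᴿ (leftᴿ x)) (leftᴿ (rightᴿ x)))
    (ifZeroᴿ
      (testᴿ X (leftᴿ (rightᴿ c)) m (constᴿ 1) (rightᴿ (rightᴿ c)) (leftᴿ kl) +ᴿ
       testᴿ X (leftᴿ b) m (leftᴿ (rightᴿ b)) (rightᴿ (rightᴿ b)) (rightᴿ kl))
      (sucᴿ c) zero-recursive)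
    where
    x : Recursive {1} (λ xs → lookup xs 0F)
    x = var 0F
    s b : Recursive {2} _
    s = var 0F
    b = var 1F
    c = leftᴿ s
    m = leftᴿ (rightᴿ (rightᴿ s))
    kl = rightᴿ (rightᴿ (rightᴿ s))

  -- Position 1 of the pair `⟨ p , s ⟩` holds `s 0`, the number chosen by the oracle.
  H : PartialFunction
  H = queryFunction (λ _ → 1) (λ _ → left)

  H-computable : Computable H
  H-computable = query-computable (λ _ → 1) (λ _ → left) (constᴿ 1) (leftᴿ (var 1F))

  module _ (p : Baire) (A : ℕ → ClosedSet)
           (p⊩A : RepresentedSpace._⊩_ (Sequences (𝒜₋ X em)) p A) where

    q : Baire
    q = query (λ s → question (decode s)) (λ s → answer (decode s)) p

    q-encode : ∀ s → q (encode s) ≡ answer s (p (question s))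
    q-encode s = cong (λ s → answer s (p (question s))) (decode-encode s)

    excluded-sound : ∀ s c → answer s (p (question s)) ≡ suc c → ¬ Inside X A c
    excluded-sound s@(c′ , j , m , k , l) c e inside
      with ifZero-suc {meets s (p (question s))} e
    ... | e₀ , refl =
      from (p⊩A (left c) (α m))
        (j , test-sound X (left b) m (left (right b)) (right (right b)) l
          (ℕ.m+n≡0⇒n≡0 (test X (left (right c)) m 1 (right (right c)) k) e₀))
        (inside (α m) (test-sound X (left (right c)) m 1 (right (right c)) k
          (ℕ.m+n≡0⇒m≡0 (test X (left (right c)) m 1 (right (right c)) k) e₀)))
      where b = p (pair (left c) j)

    excluded-by : ∀ c j m → Near X (α (left (right c))) (rad (right (right c))) (α m) →
                  Ball (p (pair (left c) j)) (α m) → ∃[ s ] q s ≡ suc c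
    excluded-by c j m am bm =
      let b      = p (pair (left c) j)
          k , e  = test-complete X (left (right c)) m 1 (right (right c)) am
          l , e′ = test-complete X (left b) m (left (right b)) (right (right b)) bm
      in encode (c , j , m , k , l) ,
         trans (q-encode (c , j , m , k , l))
           (cong (λ t → ifZero t (suc c) 0) (cong₂ _+_ e e′))

    -- A point of the ball outside the closed set lies in an enumerated ball. A dense point common
    -- to both balls passes both tests at some finite precision.
    excluded-complete : ∀ c → ¬ Inside X A c → ∃[ s ] q s ≡ suc c
    excluded-complete c ¬inside =
      let y , ay , y∉A = outside-point X em {proj₁ (A (left c))} {left (right c)} {right (right c)} ¬inside
          j , by       = to (p⊩A (left c) y) y∉A
          m , am , bm  = common-point X (left (right c)) (right (right c))
                           (p (pair (left c) j)) y ay by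
      in excluded-by c j m am bm

    q⊩Inside : RepresentedSpace._⊩_ (𝒜₋ℕ em) q (Inside X A)
    q⊩Inside c = mk⇔ (excluded-complete c) (λ (s , e) → excluded-sound (decode s) c e)

  reduction : Complete → BCT em X ≤W Cℕ em
  reduction complete = H , K , H-computable , K-computable , λ G G⊢ p A p⊩A cover →
    let r , graph , n , r⊩n , inside =
          -- The Baire category theorem puts the set of codes into the domain of closed choice.
          G⊢ (q p A p⊩A) (Inside X A) (q⊩Inside p A p⊩A) (baire X complete A em cover)
        s = r 0
    in (λ _ → left s) ,
       (q p A p⊩A , r , (λ _ → refl) , graph , λ _ → refl) ,
       -- The center and radius of the chosen ball witness the non-empty interior.
       left s , refl , α (left (right s)) , rad (right (right s)) ,
       rad-positive (right (right s)) , subst (Inside X A) (sym r⊩n) inside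

-- Closed choice from the Baire category problem

module Cℕ≤BCT (em : ExcludedMiddle 0ℓ) (X : ComputableMetricSpace) where
  open ComputableMetricSpace X

  -- The absolute difference, serving as a recursive equality test.
  differ : ℕ → ℕ → ℕ
  differ m n = (m ∸ n) + (n ∸ m)

  differ-sound : ∀ m n → differ m n ≡ 0 → m ≡ n
  differ-sound m n e = ℕ.≤-antisym (ℕ.m∸n≡0⇒m≤n (ℕ.m+n≡0⇒m≡0 (m ∸ n) e))
                                   (ℕ.m∸n≡0⇒m≤n (ℕ.m+n≡0⇒n≡0 (m ∸ n) e))

  differ-refl : ∀ n → differ n n ≡ 0
  differ-refl n = cong₂ _+_ (ℕ.n∸n≡0 n) (ℕ.n∸n≡0 n)

  -- Entry `k` codes a position of the given name and a ball. If that position excludes `n`, the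
  -- ball is listed, so that all balls appear; otherwise 0 codes an empty ball.
  answer : ℕ → ℕ → ℕ → ℕ
  answer n k b = ifZero (differ b (suc n)) (right k) 0

  K : PartialFunction
  K = queryFunction (λ s → left (right s)) (λ s → answer (left s) (right s))

  K-computable : Computable K
  K-computable = query-computable (λ s → left (right s)) (λ s → answer (left s) (right s))
    (leftᴿ (rightᴿ (var 0F)))
    (ifZeroᴿ ((b ∸ᴿ n) +ᴿ (n ∸ᴿ b)) (rightᴿ (rightᴿ (var 0F))) zero-recursive)
    where
    b : Recursive {2} (λ xs → lookup xs 1F)
    b = var 1F
    n : Recursive {2} (λ xs → suc (left (lookup xs 0F)))
    n = sucᴿ (leftᴿ (var 0F))

  H : PartialFunction
  H = queryFunction (λ _ → 1) (λ _ b → b)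

  H-computable : Computable H
  H-computable = query-computable (λ _ → 1) (λ _ b → b) (constᴿ 1) (var 1F)

  -- The complement is everything or nothing, so any radius works and `P` need not be decided.
  constantSet : Set → ClosedSet
  constantSet P = (λ _ → P) , λ _ ¬P → 1ℚ , ℚ.positive⁻¹ 1ℚ , λ _ _ → ¬P

  empty-ball : ∀ {x} → ¬ Ball 0 x
  empty-ball {x} near = ℚ.<-irrefl refl (fromℚ-cancel-< {0ℚ} {0ℚ}
    (≤-<ℝ-trans 0ℝ (d (α 0) x) {0ℚ} nonNegative near))

  -- Listing all ball codes therefore covers the space, which names the empty set.
  unit-ball : ∀ x → ∃[ c ] Ball c x
  unit-ball x =
    let m , xm = dense x 1ℚ (ℚ.positive⁻¹ 1ℚ)
    in pair m (pair 1 0) , subst (λ S → S) (sym (ball≡ m)) (near-sym X x (α m) {1ℚ} xm)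
    where
    ball≡ : ∀ m → Ball (pair m (pair 1 0)) x ≡ Near X (α m) 1ℚ x
    ball≡ m rewrite unpair-pair m (pair 1 0) | unpair-pair 1 0 = refl

  module _ (p : Baire) (A : ℕ → Set)
           (p⊩A : RepresentedSpace._⊩_ (𝒜₋ℕ em) p A) where

    q : Baire
    q = query (λ s → left (right s)) (λ s → answer (left s) (right s)) p

    q-pair : ∀ n k → q (pair n k) ≡ answer n k (p (left k))
    q-pair n k = cong₂ (λ n k → answer n k (p (left k))) (left-pair n k) (right-pair n k)

    q-sound : ∀ n k x → Ball (q (pair n k)) x → ¬ A n
    q-sound n k x near with differ (p (left k)) (suc n) in e
                          | subst (λ c → Ball c x) (q-pair n k) near
    ... | zero  | _     = from (p⊩A n) (left k , differ-sound _ _ e)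
    ... | suc _ | near′ = contradiction near′ empty-ball

    q-complete : ∀ n x → ¬ A n → ∃[ k ] Ball (q (pair n k)) x
    q-complete n x n∉A =
      let j , e  = to (p⊩A n) n∉A
          c , xc = unit-ball x
          k      = pair j c
          zero≡  = trans (cong (λ b → differ b (suc n)) (trans (cong p (left-pair j c)) e))
                     (differ-refl (suc n))
      in k , subst (λ c → Ball c x)
           (sym (trans (q-pair n k)
             (trans (cong (λ t → ifZero t (right k) 0) zero≡) (right-pair j c)))) xc

    q⊩ : RepresentedSpace._⊩_ (Sequences (𝒜₋ X em)) q (λ n → constantSet (A n))
    q⊩ n x = mk⇔ (q-complete n x) (λ (k , near) → q-sound n k x near)

  reduction : Cℕ em ≤W BCT em X
  reduction = H , K , H-computable , K-computable , λ G G⊢ p A p⊩A (n , n∈A) →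
    let r , graph , m , r⊩m , x , ε , 0<ε , inside =
          -- An element `n` of `A` makes the `n`-th set the whole space, so this one index covers
          -- every point.
          G⊢ (q p A p⊩A) (λ n → constantSet (A n)) (q⊩ p A p⊩A) (λ _ → n , n∈A)
    in (λ _ → r 0) , (q p A p⊩A , r , (λ _ → refl) , graph , λ _ → refl) ,
       -- An interior point belongs to its set, and membership in the constant set at `m` is `A m`.
       r 0 , refl , subst A (sym r⊩m) (inside x (near-refl X x {ε} 0<ε))

theorem5p2 : (em : ExcludedMiddle 0ℓ) (X : ComputableMetricSpace) →
    ComputableMetricSpace.Carrier X → ComputableMetricSpace.Complete X →
    BCT em X ≡W Cℕ em
theorem5p2 em X _ complete = BCT≤Cℕ.reduction em X complete , Cℕ≤BCT.reduction em X
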